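{- For all $n\ge1$ and $(i,j)\in\mathbb Z^2$, $\psi_{n,n}(x_{i,j})$ equals the sum of the weights of all $n$-reversed-stair paths of $(i,j)$. Explicitly, $$\psi_{n,n}(x_{i,j})=\sum\left(x_{i+\sum_{s=1}^{k}r_s,\;j-\sum_{t=1}^{k}d_t}\prod_{v=1}^{k}\frac{x_{i-1+\sum_{s=1}^{v-1}r_s,\;j-\sum_{t=1}^{v-1}d_t}}{x_{i-1+\sum_{s=1}^{v}r_s,\;j-\sum_{t=1}^{v-1}d_t}}\cdot\frac{x_{i+\sum_{s=1}^{v}r_s,\;j+1-\sum_{t=1}^{v-1}d_t}}{x_{i+\sum_{s=1}^{v}r_s,\;j+1-\sum_{t=1}^{v}d_t}}\right),$$ where the sum is over all $k\ge1$ and integers $r_1\ge0$, $r_2,\dots,r_k\ge1$, $d_1,\dots,d_{k-1}\ge1$, $d_k\ge0$ with $\sum_{v=1}^k(r_v+d_v)=n$.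
   Context: Let $x_{i,j}$, $(i,j)\in\mathbb Z^2$, be independent variables. For integers $k\ge0$, $0\le t\le k+1$, define $\psi_{t,k}(x_{i,j})$ (Laurent polynomials in the variables) recursively by $\psi_{0,k}(x_{i,j})=\psi_{k+1,k}(x_{i,j})=x_{i,j}$, $$\psi_{1,1}(x_{i,j})=\frac{x_{i-1,j}x_{i+1,j}+x_{i,j-1}x_{i,j+1}}{x_{i,j}},$$ $$\psi_{t+1,k+2}(x_{i,j})=\frac{\psi_{t+1,k+1}(x_{i-1,j})\psi_{t,k+1}(x_{i+1,j})+\psi_{t,k+1}(x_{i,j-1})\psi_{t+1,k+1}(x_{i,j+1})}{\psi_{t,k}(x_{i,j})}\qquad(k\ge 0,\ 0\le t\le k+1).$$ **$n$-reversed-stair path of $(i,j)$.** An alternating sequence of right segments (horizontal segments directed right) and down segments (vertical segments directed down), of positive integer lengths with total length $n$, such that: - the first segment, right or down, has $(i,j)$ as its second lattice point (so its tail is $(i-1,j)$ if it is right, $(i,j+1)$ if it is down); - if a right segment ends at its head $(p,q)$, the next (down) segment has tail $(p+1,q+1)$; - if a down segment ends at its head $(p,q)$, the next (right) segment has tail $(p-1,q-1)$. The ending point $E$ is one further step (right, respectively down) beyond the head of the last segment. Thus $E=(i+\rho,j-\delta)$ where $\rho,\delta$ are the total lengths of the right and down segments. The weight of a segment from tail $a$ to head $b$ is $x_a/x_b$. The weight of a path is the product of its segment weights times $x_E$. -}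

module Defs where

open import Algebra.Bundles using (CommutativeRing)
open import Data.Bool.Base as Bool using (true; false; if_then_else_)
open import Data.Empty using (⊥)
open import Data.Integer.Base as ℤ using (ℤ; +_; 0ℤ; 1ℤ; _+_; _-_; _*_; -_; ∣_∣)
import Data.Integer.Properties as ℤₚ
import Data.Integer.Tactic.RingSolver as ℤ-Solver
open import Data.List.Base using (List; []; _∷_; [_]; _++_; map; foldr; take; drop; applyUpTo)
open import Data.List.Membership.Propositional using (_∈_)
open import Data.List.Membership.Propositional.Properties
  using (∈-map⁺; ∈-++⁺ˡ; ∈-++⁺ʳ)
open import Data.List.NonEmpty.Base as List⁺ using (List⁺; _∷_; _∷⁺_; toList)
open import Data.List.Relation.Unary.All as All using (All; []; _∷_)
import Data.List.Relation.Unary.All.Properties as Allₚ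
open import Data.List.Relation.Unary.AllPairs using ([]; _∷_)
open import Data.List.Relation.Unary.Any using (here)
open import Data.List.Relation.Unary.Linked using (Linked; []; [-]; _∷_)
open import Data.List.Relation.Unary.Unique.Propositional using (Unique)
import Data.List.Relation.Unary.Unique.Propositional.Properties as Uniqueₚ
open import Data.Nat.Base as ℕ using (ℕ; zero; suc; z≤n; s≤s; _≤_; _⊔_)
open import Data.Nat.ListAction using (sum)
import Data.Nat.Properties as ℕₚ
open import Data.Product.Base using (_×_; _,_; proj₁; proj₂; ∃-syntax)
open import Data.Sum.Base using (_⊎_; inj₁; inj₂)
open import Level using (0ℓ)
open import Relation.Binary.PropositionalEquality
  using (_≡_; _≢_; refl; sym; trans; cong; cong₂; subst)
open import Relation.Nullary using (¬_; yes; no; contradiction)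

------------------------------------------------------------------------
-- The lattice

Point : Set
Point = ℤ × ℤ

------------------------------------------------------------------------
-- The polynomial ring ℤ[ x_a ∣ a ∈ ℤ² ], as the free commutative ring on
-- Point: terms modulo the congruence generated by the ring axioms.

infixl 6 _+ₚ_
infixl 7 _*ₚ_
infix  8 -ₚ_
infix  4 _≈ₚ_

data Poly : Set where
  var       : Point → Poly
  0ₚ 1ₚ     : Poly
  _+ₚ_ _*ₚ_ : Poly → Poly → Poly
  -ₚ_       : Poly → Poly

data _≈ₚ_ : Poly → Poly → Set where
  ≈-refl      : ∀ {p} → p ≈ₚ p
  ≈-sym       : ∀ {p q} → p ≈ₚ q → q ≈ₚ p
  ≈-trans     : ∀ {p q r} → p ≈ₚ q → q ≈ₚ r → p ≈ₚ r
  +-cong      : ∀ {p p′ q q′} → p ≈ₚ p′ → q ≈ₚ q′ → p +ₚ q ≈ₚ p′ +ₚ q′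
  *-cong      : ∀ {p p′ q q′} → p ≈ₚ p′ → q ≈ₚ q′ → p *ₚ q ≈ₚ p′ *ₚ q′
  -‿cong      : ∀ {p p′} → p ≈ₚ p′ → -ₚ p ≈ₚ -ₚ p′
  +-assoc     : ∀ p q r → (p +ₚ q) +ₚ r ≈ₚ p +ₚ (q +ₚ r)
  +-comm      : ∀ p q → p +ₚ q ≈ₚ q +ₚ p
  +-identityˡ : ∀ p → 0ₚ +ₚ p ≈ₚ p
  -‿inverseˡ  : ∀ p → -ₚ p +ₚ p ≈ₚ 0ₚ
  *-assoc     : ∀ p q r → (p *ₚ q) *ₚ r ≈ₚ p *ₚ (q *ₚ r)
  *-comm      : ∀ p q → p *ₚ q ≈ₚ q *ₚ p
  *-identityˡ : ∀ p → 1ₚ *ₚ p ≈ₚ p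
  distribʳ    : ∀ p q r → (q +ₚ r) *ₚ p ≈ₚ q *ₚ p +ₚ r *ₚ p

Poly-commutativeRing : CommutativeRing 0ℓ 0ℓ
Poly-commutativeRing = record
  { Carrier = Poly ; _≈_ = _≈ₚ_
  ; _+_ = _+ₚ_ ; _*_ = _*ₚ_ ; -_ = -ₚ_ ; 0# = 0ₚ ; 1# = 1ₚ
  ; isCommutativeRing = record
    { isRing = record
      { +-isAbelianGroup = record
        { isGroup = record
          { isMonoid = record
            { isSemigroup = record
              { isMagma = record
                { isEquivalence = record { refl = ≈-refl ; sym = ≈-sym ; trans = ≈-trans }
                ; ∙-cong = +-cong }
              ; assoc = +-assoc }
            ; identity = +-identityˡ , λ p → ≈-trans (+-comm p 0ₚ) (+-identityˡ p) }
          ; inverse = -‿inverseˡ , λ p → ≈-trans (+-comm p (-ₚ p)) (-‿inverseˡ p)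
          ; ⁻¹-cong = -‿cong }
        ; comm = +-comm }
      ; *-cong = *-cong
      ; *-assoc = *-assoc
      ; *-identity = *-identityˡ , λ p → ≈-trans (*-comm p 1ₚ) (*-identityˡ p)
      ; distrib = (λ p q r → ≈-trans (*-comm p (q +ₚ r)) (≈-trans (distribʳ p q r)
                               (+-cong (*-comm q p) (*-comm r p))))
                , distribʳ }
    ; *-comm = *-comm } }

-- Evaluation at an integer point.
⟦_⟧ : Poly → (Point → ℤ) → ℤ
⟦ var a  ⟧ ρ = ρ a
⟦ 0ₚ     ⟧ ρ = 0ℤ
⟦ 1ₚ     ⟧ ρ = 1ℤ
⟦ p +ₚ q ⟧ ρ = ⟦ p ⟧ ρ + ⟦ q ⟧ ρ
⟦ p *ₚ q ⟧ ρ = ⟦ p ⟧ ρ * ⟦ q ⟧ ρ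
⟦ -ₚ p   ⟧ ρ = - ⟦ p ⟧ ρ

⟦⟧-sound : ∀ {p q} → p ≈ₚ q → ∀ ρ → ⟦ p ⟧ ρ ≡ ⟦ q ⟧ ρ
⟦⟧-sound ≈-refl ρ = refl
⟦⟧-sound (≈-sym e) ρ = sym (⟦⟧-sound e ρ)
⟦⟧-sound (≈-trans e f) ρ = trans (⟦⟧-sound e ρ) (⟦⟧-sound f ρ)
⟦⟧-sound (+-cong e f) ρ = cong₂ _+_ (⟦⟧-sound e ρ) (⟦⟧-sound f ρ)
⟦⟧-sound (*-cong e f) ρ = cong₂ _*_ (⟦⟧-sound e ρ) (⟦⟧-sound f ρ)
⟦⟧-sound (-‿cong e) ρ = cong -_ (⟦⟧-sound e ρ)
⟦⟧-sound (+-assoc p q r) ρ = ℤₚ.+-assoc (⟦ p ⟧ ρ) (⟦ q ⟧ ρ) (⟦ r ⟧ ρ)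
⟦⟧-sound (+-comm p q) ρ = ℤₚ.+-comm (⟦ p ⟧ ρ) (⟦ q ⟧ ρ)
⟦⟧-sound (+-identityˡ p) ρ = ℤₚ.+-identityˡ (⟦ p ⟧ ρ)
⟦⟧-sound (-‿inverseˡ p) ρ = ℤₚ.+-inverseˡ (⟦ p ⟧ ρ)
⟦⟧-sound (*-assoc p q r) ρ = ℤₚ.*-assoc (⟦ p ⟧ ρ) (⟦ q ⟧ ρ) (⟦ r ⟧ ρ)
⟦⟧-sound (*-comm p q) ρ = ℤₚ.*-comm (⟦ p ⟧ ρ) (⟦ q ⟧ ρ)
⟦⟧-sound (*-identityˡ p) ρ = ℤₚ.*-identityˡ (⟦ p ⟧ ρ)
⟦⟧-sound (distribʳ p q r) ρ = ℤₚ.*-distribʳ-+ (⟦ p ⟧ ρ) (⟦ q ⟧ ρ) (⟦ r ⟧ ρ)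

-- Being a nonzero polynomial, in positive form: ℤ is an infinite domain, so
-- an integer polynomial is nonzero iff it is nonzero at some integer point.
NonZeroₚ : Poly → Set
NonZeroₚ p = ∃[ ρ ] ⟦ p ⟧ ρ ≢ 0ℤ

NonZeroₚ⇒≉0 : ∀ {p} → NonZeroₚ p → ¬ p ≈ₚ 0ₚ
NonZeroₚ⇒≉0 (ρ , pρ≢0) p≈0 = pρ≢0 (⟦⟧-sound p≈0 ρ)

-- Products of nonzero polynomials are nonzero: restrict both factors to the
-- line through a point where the first and a point where the second does not
-- vanish; a nonzero univariate polynomial is nonzero at all large integers.
private

  ev : List ℤ → ℤ → ℤ
  ev []       t = 0ℤ
  ev (c ∷ cs) t = c + t * ev cs t

  _⊞_ : List ℤ → List ℤ → List ℤ
  []       ⊞ ds       = ds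
  (c ∷ cs) ⊞ []       = c ∷ cs
  (c ∷ cs) ⊞ (d ∷ ds) = c + d ∷ cs ⊞ ds

  scale : ℤ → List ℤ → List ℤ
  scale k = map (k *_)

  _⊠_ : List ℤ → List ℤ → List ℤ
  []       ⊠ ds = []
  (c ∷ cs) ⊠ ds = scale c ds ⊞ (0ℤ ∷ cs ⊠ ds)

  ev-⊞ : ∀ cs ds t → ev (cs ⊞ ds) t ≡ ev cs t + ev ds t
  ev-⊞ []       ds       t = sym (ℤₚ.+-identityˡ _)
  ev-⊞ (c ∷ cs) []       t = sym (ℤₚ.+-identityʳ _)
  ev-⊞ (c ∷ cs) (d ∷ ds) t rewrite ev-⊞ cs ds t = lemma c d t (ev cs t) (ev ds t)
    where
    lemma : ∀ c d t u v → c + d + t * (u + v) ≡ c + t * u + (d + t * v)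
    lemma = ℤ-Solver.solve-∀

  ev-scale : ∀ k cs t → ev (scale k cs) t ≡ k * ev cs t
  ev-scale k []       t = sym (ℤₚ.*-zeroʳ k)
  ev-scale k (c ∷ cs) t rewrite ev-scale k cs t = lemma k c t (ev cs t)
    where
    lemma : ∀ k c t u → k * c + t * (k * u) ≡ k * (c + t * u)
    lemma = ℤ-Solver.solve-∀

  ev-⊠ : ∀ cs ds t → ev (cs ⊠ ds) t ≡ ev cs t * ev ds t
  ev-⊠ []       ds t = refl
  ev-⊠ (c ∷ cs) ds t
    rewrite ev-⊞ (scale c ds) (0ℤ ∷ cs ⊠ ds) t | ev-scale c ds t | ev-⊠ cs ds t
    = lemma c t (ev cs t) (ev ds t)
    where
    lemma : ∀ c t u v → c * v + (0ℤ + t * (u * v)) ≡ (c + t * u) * v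
    lemma = ℤ-Solver.solve-∀

  line : (ρ σ : Point → ℤ) → ℤ → Point → ℤ
  line ρ σ t a = ρ a + t * (σ a - ρ a + t * 0ℤ)

  restrict : (ρ σ : Point → ℤ) → Poly → List ℤ
  restrict ρ σ (var a)  = ρ a ∷ σ a - ρ a ∷ []
  restrict ρ σ 0ₚ       = []
  restrict ρ σ 1ₚ       = 1ℤ ∷ []
  restrict ρ σ (p +ₚ q) = restrict ρ σ p ⊞ restrict ρ σ q
  restrict ρ σ (p *ₚ q) = restrict ρ σ p ⊠ restrict ρ σ q
  restrict ρ σ (-ₚ p)   = scale (- 1ℤ) (restrict ρ σ p)

  ev-restrict : ∀ ρ σ p t → ev (restrict ρ σ p) t ≡ ⟦ p ⟧ (line ρ σ t)
  ev-restrict ρ σ (var a)  t = refl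
  ev-restrict ρ σ 0ₚ       t = refl
  ev-restrict ρ σ 1ₚ       t = cong (λ z → 1ℤ + z) (ℤₚ.*-zeroʳ t)
  ev-restrict ρ σ (p +ₚ q) t = trans (ev-⊞ (restrict ρ σ p) (restrict ρ σ q) t)
    (cong₂ _+_ (ev-restrict ρ σ p t) (ev-restrict ρ σ q t))
  ev-restrict ρ σ (p *ₚ q) t = trans (ev-⊠ (restrict ρ σ p) (restrict ρ σ q) t)
    (cong₂ _*_ (ev-restrict ρ σ p t) (ev-restrict ρ σ q t))
  ev-restrict ρ σ (-ₚ p)   t = trans (ev-scale (- 1ℤ) (restrict ρ σ p) t)
    (trans (ℤₚ.-1*i≡-i _) (cong -_ (ev-restrict ρ σ p t)))

  ⟦⟧-ext : ∀ p {ρ σ} → (∀ a → ρ a ≡ σ a) → ⟦ p ⟧ ρ ≡ ⟦ p ⟧ σ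
  ⟦⟧-ext (var a)  e = e a
  ⟦⟧-ext 0ₚ       e = refl
  ⟦⟧-ext 1ₚ       e = refl
  ⟦⟧-ext (p +ₚ q) e = cong₂ _+_ (⟦⟧-ext p e) (⟦⟧-ext q e)
  ⟦⟧-ext (p *ₚ q) e = cong₂ _*_ (⟦⟧-ext p e) (⟦⟧-ext q e)
  ⟦⟧-ext (-ₚ p)   e = cong -_ (⟦⟧-ext p e)

  eventually-nonzero : ∀ cs → (∀ t → ev cs t ≡ 0ℤ) ⊎
                              (∃[ T ] ∀ t → T ≤ t → ev cs (+ t) ≢ 0ℤ)
  eventually-nonzero [] = inj₁ λ _ → refl
  eventually-nonzero (c ∷ cs) with eventually-nonzero cs
  ... | inj₁ cs≡0 with c ℤₚ.≟ 0ℤ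
  ...   | yes refl = inj₁ λ t → trans (cong (λ z → 0ℤ + t * z) (cs≡0 t))
                                      (trans (ℤₚ.+-identityˡ _) (ℤₚ.*-zeroʳ t))
  ...   | no c≢0 = inj₂ (0 , λ t _ e → c≢0 (trans (sym (ℤₚ.+-identityʳ c))
                     (trans (cong (λ z → c + z) (sym (trans (cong (+ t *_) (cs≡0 (+ t))) (ℤₚ.*-zeroʳ (+ t))))) e)))
  eventually-nonzero (c ∷ cs) | inj₂ (T , h) = inj₂ (T ⊔ suc ∣ c ∣ , bound)
    where
    bound : ∀ t → T ⊔ suc ∣ c ∣ ≤ t → ev (c ∷ cs) (+ t) ≢ 0ℤ
    bound t T≤t e = ℕₚ.<-irrefl refl (begin-strict
      ∣ c ∣                       <⟨ ℕₚ.m⊔n≤o⇒n≤o T _ T≤t ⟩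
      t                           ≤⟨ ℕₚ.m≤m*n t ∣ u ∣ ⦃ ℕ.≢-nonZero (λ z → h t (ℕₚ.m⊔n≤o⇒m≤o T _ T≤t) (ℤₚ.∣i∣≡0⇒i≡0 z)) ⦄ ⟩
      t ℕ.* ∣ u ∣                 ≡⟨ sym (ℤₚ.abs-* (+ t) u) ⟩
      ∣ + t * u ∣                 ≡⟨ sym (ℤₚ.∣-i∣≡∣i∣ (+ t * u)) ⟩
      ∣ - (+ t * u) ∣             ≡⟨ cong ∣_∣ (sym c≡) ⟩
      ∣ c ∣                       ∎)
      where
      open ℕₚ.≤-Reasoning
      u = ev cs (+ t)
      lemma : ∀ c v → c ≡ c + v - v
      lemma = ℤ-Solver.solve-∀
      c≡ : c ≡ - (+ t * u)
      c≡ = trans (lemma c (+ t * u)) (trans (cong (_- (+ t * u)) e) (ℤₚ.+-identityˡ _))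

  eventually : ∀ cs s → ev cs s ≢ 0ℤ → ∃[ T ] ∀ t → T ≤ t → ev cs (+ t) ≢ 0ℤ
  eventually cs s ≢0 with eventually-nonzero cs
  ... | inj₁ ≡0 = contradiction (≡0 s) ≢0
  ... | inj₂ r  = r

  nonZero-* : ∀ p q → NonZeroₚ p → NonZeroₚ q → NonZeroₚ (p *ₚ q)
  nonZero-* p q (ρ , pρ≢0) (σ , qσ≢0) = line ρ σ t , λ e →
    noZeroDivisor (ℤₚ.i*j≡0⇒i≡0∨j≡0 (⟦ p ⟧ (line ρ σ t)) e)
    where
    line0 : ∀ r s → r + 0ℤ * (s - r + 0ℤ * 0ℤ) ≡ r
    line0 = ℤ-Solver.solve-∀
    line1 : ∀ r s → r + 1ℤ * (s - r + 1ℤ * 0ℤ) ≡ s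
    line1 = ℤ-Solver.solve-∀
    P = eventually (restrict ρ σ p) 0ℤ λ e → pρ≢0
          (trans (sym (⟦⟧-ext p (λ a → line0 (ρ a) (σ a)))) (trans (sym (ev-restrict ρ σ p 0ℤ)) e))
    Q = eventually (restrict ρ σ q) 1ℤ λ e → qσ≢0
          (trans (sym (⟦⟧-ext q (λ a → line1 (ρ a) (σ a)))) (trans (sym (ev-restrict ρ σ q 1ℤ)) e))
    T = proj₁ P ⊔ proj₁ Q
    t = + T
    noZeroDivisor : ¬ (⟦ p ⟧ (line ρ σ t) ≡ 0ℤ ⊎ ⟦ q ⟧ (line ρ σ t) ≡ 0ℤ)
    noZeroDivisor (inj₁ e) = proj₂ P T (ℕₚ.m≤m⊔n (proj₁ P) (proj₁ Q)) (trans (ev-restrict ρ σ p t) e)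
    noZeroDivisor (inj₂ e) = proj₂ Q T (ℕₚ.m≤n⊔m (proj₁ P) (proj₁ Q)) (trans (ev-restrict ρ σ q t) e)

abstract

  NonZeroₚ-* : ∀ p q → NonZeroₚ p → NonZeroₚ q → NonZeroₚ (p *ₚ q)
  NonZeroₚ-* = nonZero-*

------------------------------------------------------------------------
-- The field of rational functions ℚ(x_a ∣ a ∈ ℤ²): fractions of integer
-- polynomials.

record RatFun : Set where
  constructor frac
  field
    num den : Poly
    den≢0   : NonZeroₚ den

open RatFun public

-- The usual equality of a localisation.  Since polynomials form a domain, s
-- can be cancelled; keeping it makes transitivity immediate.
infix 4 _≃_
_≃_ : RatFun → RatFun → Set
f ≃ g = ∃[ s ] NonZeroₚ s × s *ₚ (num f *ₚ den g) ≈ₚ s *ₚ (num g *ₚ den f)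

infixl 6 _⊕_
infixl 7 _⊗_ _÷_

NonZeroᵣ : RatFun → Set
NonZeroᵣ f = NonZeroₚ (num f)

polynomial : Poly → RatFun
polynomial p = frac p 1ₚ ((λ _ → 0ℤ) , λ ())

x : Point → RatFun
x a = polynomial (var a)

0ᵣ 1ᵣ : RatFun
0ᵣ = polynomial 0ₚ
1ᵣ = polynomial 1ₚ

_⊕_ _⊗_ : RatFun → RatFun → RatFun
f ⊕ g = frac (num f *ₚ den g +ₚ num g *ₚ den f) (den f *ₚ den g)
             (NonZeroₚ-* (den f) (den g) (den≢0 f) (den≢0 g))
f ⊗ g = frac (num f *ₚ num g) (den f *ₚ den g)
             (NonZeroₚ-* (den f) (den g) (den≢0 f) (den≢0 g))

_÷_ : (f g : RatFun) → ⦃ NonZeroᵣ g ⦄ → RatFun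
_÷_ f g ⦃ g≢0 ⦄ = frac (num f *ₚ den g) (den f *ₚ num g)
                       (NonZeroₚ-* (den f) (num g) (den≢0 f) g≢0)

instance
  x-nonZero : ∀ {a} → NonZeroₚ (var a)
  x-nonZero = (λ _ → 1ℤ) , λ ()

record Positiveₚ (p : Poly) : Set where
  constructor mkPositive
  field
    at-ones : ℤ.Positive (⟦ p ⟧ λ _ → 1ℤ)

var-Positive : ∀ {a} → Positiveₚ (var a)
var-Positive = mkPositive _

1ₚ-Positive : Positiveₚ 1ₚ
1ₚ-Positive = mkPositive _

abstract

  +-Positive : ∀ {p q} → Positiveₚ p → Positiveₚ q → Positiveₚ (p +ₚ q)
  +-Positive {p} {q} (mkPositive p>0) (mkPositive q>0) =
    mkPositive (lemma (⟦ p ⟧ λ _ → 1ℤ) (⟦ q ⟧ λ _ → 1ℤ) p>0 q>0)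
    where
    lemma : ∀ i j → ℤ.Positive i → ℤ.Positive j → ℤ.Positive (i + j)
    lemma (+ suc m) (+ suc n) _ _ = _

  *-Positive : ∀ {p q} → Positiveₚ p → Positiveₚ q → Positiveₚ (p *ₚ q)
  *-Positive {p} {q} (mkPositive p>0) (mkPositive q>0) =
    mkPositive (lemma (⟦ p ⟧ λ _ → 1ℤ) (⟦ q ⟧ λ _ → 1ℤ) p>0 q>0)
    where
    lemma : ∀ i j → ℤ.Positive i → ℤ.Positive j → ℤ.Positive (i * j)
    lemma (+ suc m) (+ suc n) _ _ = _

  Positive⇒NonZero : ∀ {p} → Positiveₚ p → NonZeroₚ p
  Positive⇒NonZero {p} (mkPositive p>0) = (λ _ → 1ℤ) , lemma (⟦ p ⟧ λ _ → 1ℤ) p>0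
    where
    lemma : ∀ i → ℤ.Positive i → i ≢ 0ℤ
    lemma (+ suc m) _ ()

-- Rational functions whose numerator and denominator are positive at the
-- all-ones point.  They are nonzero and closed under addition, multiplication
-- and division, so every division in the recursion for ψ is legitimate.
record RatFun⁺ : Set where
  constructor mk⁺
  field
    value : RatFun
    num>0 : Positiveₚ (num value)
    den>0 : Positiveₚ (den value)

open RatFun⁺ public

infixl 6 _⊕⁺_
infixl 7 _⊗⁺_ _÷⁺_

x⁺ : Point → RatFun⁺
x⁺ a = mk⁺ (x a) var-Positive 1ₚ-Positive

_⊕⁺_ _⊗⁺_ _÷⁺_ : RatFun⁺ → RatFun⁺ → RatFun⁺

value (f ⊕⁺ g) = value f ⊕ value g
num>0 (f ⊕⁺ g) = +-Positive (*-Positive (num>0 f) (den>0 g)) (*-Positive (num>0 g) (den>0 f))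
den>0 (f ⊕⁺ g) = *-Positive (den>0 f) (den>0 g)

value (f ⊗⁺ g) = value f ⊗ value g
num>0 (f ⊗⁺ g) = *-Positive (num>0 f) (num>0 g)
den>0 (f ⊗⁺ g) = *-Positive (den>0 f) (den>0 g)

value (f ÷⁺ g) = _÷_ (value f) (value g) ⦃ Positive⇒NonZero (num>0 g) ⦄
num>0 (f ÷⁺ g) = *-Positive (num>0 f) (den>0 g)
den>0 (f ÷⁺ g) = *-Positive (den>0 f) (num>0 g)

------------------------------------------------------------------------
-- ψ t k (i , j) is ψ_{t,k}(x_{i,j}), for t ≤ k+1.  The test in the third
-- clause, whose t stands for one less than the index, separates the recursion
-- from the boundary value ψ_{k+1,k}(x_{i,j}) = x_{i,j}.  For t > k+1 the value
-- x_{i,j} is junk, which the recursion never uses.  The defining equations are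
-- ψ⁺-zero, ψ⁺-top, ψ⁺-one and ψ⁺-step.

ψ⁺ : (t k : ℕ) → Point → RatFun⁺
ψ⁺ zero          k             (i , j) = x⁺ (i , j)
ψ⁺ (suc t)       zero          (i , j) = x⁺ (i , j)
ψ⁺ (suc t)       (suc (suc k)) (i , j) =
  if t ℕ.≤ᵇ suc k
  then (ψ⁺ (suc t) (suc k) (i - 1ℤ , j) ⊗⁺ ψ⁺ t (suc k) (i + 1ℤ , j)
         ⊕⁺ ψ⁺ t (suc k) (i , j - 1ℤ) ⊗⁺ ψ⁺ (suc t) (suc k) (i , j + 1ℤ))
       ÷⁺ ψ⁺ t k (i , j)
  else x⁺ (i , j)
ψ⁺ (suc zero)    (suc zero)    (i , j) =
  (x⁺ (i - 1ℤ , j) ⊗⁺ x⁺ (i + 1ℤ , j) ⊕⁺ x⁺ (i , j - 1ℤ) ⊗⁺ x⁺ (i , j + 1ℤ)) ÷⁺ x⁺ (i , j)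
ψ⁺ (suc (suc t)) (suc zero)    (i , j) = x⁺ (i , j)

ψ : (t k : ℕ) → Point → RatFun
ψ t k a = value (ψ⁺ t k a)

ψ⁺-zero : ∀ k i j → ψ⁺ 0 k (i , j) ≡ x⁺ (i , j)
ψ⁺-zero k i j = refl

if-true : ∀ {A : Set} {b} {y z : A} → Bool.T b → (if b then y else z) ≡ y
if-true {b = true} _ = refl

if-false : ∀ {A : Set} {b} {y z : A} → ¬ Bool.T b → (if b then y else z) ≡ z
if-false {b = true}  ¬b = contradiction _ ¬b
if-false {b = false} _  = refl

ψ⁺-top : ∀ k i j → ψ⁺ (suc k) k (i , j) ≡ x⁺ (i , j)
ψ⁺-top zero          i j = refl
ψ⁺-top (suc zero)    i j = refl
ψ⁺-top (suc (suc k)) i j = if-false {b = suc (suc k) ℕ.≤ᵇ suc k}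
  λ b → ℕₚ.<-irrefl refl (ℕₚ.≤ᵇ⇒≤ (suc (suc k)) (suc k) b)

ψ⁺-one : ∀ i j → ψ⁺ 1 1 (i , j) ≡
  (x⁺ (i - 1ℤ , j) ⊗⁺ x⁺ (i + 1ℤ , j) ⊕⁺ x⁺ (i , j - 1ℤ) ⊗⁺ x⁺ (i , j + 1ℤ)) ÷⁺ x⁺ (i , j)
ψ⁺-one i j = refl

ψ⁺-step : ∀ k t i j → t ≤ suc k → ψ⁺ (suc t) (suc (suc k)) (i , j) ≡
  (ψ⁺ (suc t) (suc k) (i - 1ℤ , j) ⊗⁺ ψ⁺ t (suc k) (i + 1ℤ , j)
    ⊕⁺ ψ⁺ t (suc k) (i , j - 1ℤ) ⊗⁺ ψ⁺ (suc t) (suc k) (i , j + 1ℤ))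
  ÷⁺ ψ⁺ t k (i , j)
ψ⁺-step k t i j t≤k+1 = if-true {b = t ℕ.≤ᵇ suc k} (ℕₚ.≤⇒≤ᵇ t≤k+1)

------------------------------------------------------------------------
-- Finite sums and products

-- A duplicate-free list of exactly the elements satisfying P.
record Enumeration {A : Set} (P : A → Set) : Set where
  field
    elements : List A
    unique   : Unique elements
    sound    : All P elements
    complete : ∀ {a} → P a → a ∈ elements

open Enumeration public

∑ : ∀ {A : Set} {P : A → Set} → Enumeration P → (A → RatFun) → RatFun
∑ E f = foldr _⊕_ 0ᵣ (map f (elements E))

-- ∏< k f = f 0 ⊗ ⋯ ⊗ f (k - 1)
∏< : ℕ → (ℕ → RatFun) → RatFun
∏< k f = foldr _⊗_ 1ᵣ (applyUpTo f k)

Unique-map : ∀ {A B : Set} {P : A → Set} (f : A → B) →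
             (∀ {a b} → P a → P b → f a ≡ f b → a ≡ b) →
             ∀ {as} → All P as → Unique as → Unique (map f as)
Unique-map f inj []         []         = []
Unique-map f inj (pa ∷ pas) (a∉ ∷ uas) =
  Allₚ.map⁺ (All.zipWith (λ (a≢b , pb) e → a≢b (inj pa pb e)) (a∉ , pas))
  ∷ Unique-map f inj pas uas

Unique-++ : ∀ {A : Set} {P Q : A → Set} → (∀ {a} → P a → Q a → ⊥) →
            ∀ {as bs} → All P as → All Q bs → Unique as → Unique bs → Unique (as ++ bs)
Unique-++ disj pas qbs uas ubs =
  Uniqueₚ.++⁺ uas ubs λ (a∈ , b∈) → disj (All.lookup pas a∈) (All.lookup qbs b∈)

------------------------------------------------------------------------
-- Reversed-stair paths

data Direction : Set where
  right down : Direction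

advance : Direction → ℕ → Point → Point
advance right ℓ (p , q) = p + + ℓ , q
advance down  ℓ (p , q) = p , q - + ℓ

record Segment : Set where
  constructor seg
  field
    dir  : Direction
    tail : Point
    size : ℕ

  head : Point
  head = advance dir size tail

open Segment public

-- Turn d e a b: after a segment of direction d with head a may come a
-- segment of direction e with tail b.
Turn : Direction → Direction → Point → Point → Set
Turn right down  (p , q) b = b ≡ (p + 1ℤ , q + 1ℤ)
Turn down  right (p , q) b = b ≡ (p - 1ℤ , q - 1ℤ)
Turn right right _       _ = ⊥
Turn down  down  _       _ = ⊥

_⇝_ : Segment → Segment → Set
s ⇝ s′ = Turn (dir s) (dir s′) (head s) (tail s′)

Path : Set
Path = List⁺ Segment

record IsStairPath (n : ℕ) (a : Point) (π : Path) : Set where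
  field
    second-point : advance (dir (List⁺.head π)) 1 (tail (List⁺.head π)) ≡ a
    turns        : Linked _⇝_ (toList π)
    positive     : All (λ s → 1 ≤ size s) (toList π)
    total        : sum (map size (toList π)) ≡ n

-- The point one step beyond the head of the last segment.
endpoint : Path → Point
endpoint (s ∷ ss) = go s ss
  where
  go : Segment → List Segment → Point
  go s []        = advance (dir s) 1 (head s)
  go s (s′ ∷ ss) = go s′ ss

weight : Path → RatFun
weight π = foldr _⊗_ 1ᵣ (map (λ s → x (tail s) ÷ x (head s)) (toList π)) ⊗ x (endpoint π)

opposite : Direction → Direction
opposite right = down
opposite down  = right

corner : Direction → Point → Point
corner right (p , q) = p + 1ℤ , q + 1ℤ
corner down  (p , q) = p - 1ℤ , q - 1ℤ

Turn-corner : ∀ d a → Turn d (opposite d) a (corner d a)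
Turn-corner right a = refl
Turn-corner down  a = refl

Turn⁻ : ∀ d e a b → Turn d e a b → e ≡ opposite d × b ≡ corner d a
Turn⁻ right down  a b eq = refl , eq
Turn⁻ down  right a b eq = refl , eq

advance-suc : ∀ d ℓ a → advance d ℓ (advance d 1 a) ≡ advance d (suc ℓ) a
advance-suc right ℓ (p , q) = cong (_, q) (lemma p (+ ℓ))
  where
  lemma : ∀ p m → p + 1ℤ + m ≡ p + (1ℤ + m)
  lemma = ℤ-Solver.solve-∀
advance-suc down ℓ (p , q) = cong (p ,_) (lemma q (+ ℓ))
  where
  lemma : ∀ q m → q - 1ℤ - m ≡ q - (1ℤ + m)
  lemma = ℤ-Solver.solve-∀

retreat : Direction → Point → Point
retreat right (p , q) = p - 1ℤ , q
retreat down  (p , q) = p , q + 1ℤ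

advance-retreat : ∀ d a → advance d 1 (retreat d a) ≡ a
advance-retreat right (p , q) = cong (_, q) (lemma p)
  where
  lemma : ∀ p → p - 1ℤ + 1ℤ ≡ p
  lemma = ℤ-Solver.solve-∀
advance-retreat down (p , q) = cong (p ,_) (lemma q)
  where
  lemma : ∀ q → q + 1ℤ - 1ℤ ≡ q
  lemma = ℤ-Solver.solve-∀

retreat-advance : ∀ d a → retreat d (advance d 1 a) ≡ a
retreat-advance right (p , q) = cong (_, q) (lemma p)
  where
  lemma : ∀ p → p + 1ℤ - 1ℤ ≡ p
  lemma = ℤ-Solver.solve-∀
retreat-advance down (p , q) = cong (p ,_) (lemma q)
  where
  lemma : ∀ q → q - 1ℤ + 1ℤ ≡ q
  lemma = ℤ-Solver.solve-∀

-- Paths of total length n + 1 whose first segment has direction d and tail a.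
record IsChain (d : Direction) (a : Point) (n : ℕ) (π : Path) : Set where
  constructor mkChain
  field
    isDir    : dir (List⁺.head π) ≡ d
    isTail   : tail (List⁺.head π) ≡ a
    turns    : Linked _⇝_ (toList π)
    positive : All (λ s → 1 ≤ size s) (toList π)
    total    : sum (map size (toList π)) ≡ suc n

lengthen : Direction → Point → Path → Path
lengthen d a (s ∷ ss) = seg d a (suc (size s)) ∷ ss

chains : Direction → Point → ℕ → List Path
chains d a zero    = [ seg d a 1 ∷ [] ]
chains d a (suc n) =
  map (lengthen d a) (chains d (advance d 1 a) n) ++
  map (seg d a 1 ∷⁺_) (chains (opposite d) (corner d (advance d 1 a)) n)

lengthen-sound : ∀ {d a n π} → IsChain d (advance d 1 a) n π → IsChain d a (suc n) (lengthen d a π)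
lengthen-sound {d} {a} {π = s ∷ []} (mkChain refl refl _ (_ ∷ _) e) =
  mkChain refl refl [-] (s≤s z≤n ∷ []) (cong suc e)
lengthen-sound {d} {a} {π = s ∷ s′ ∷ ss} (mkChain refl refl (r ∷ rs) (_ ∷ ps) e) =
  mkChain refl refl
    (subst (λ b → Turn d (dir s′) b (tail s′)) (advance-suc d (size s) a) r ∷ rs)
    (s≤s z≤n ∷ ps) (cong suc e)

turn-sound : ∀ {d a n π} → IsChain (opposite d) (corner d (advance d 1 a)) n π →
             IsChain d a (suc n) (seg d a 1 ∷⁺ π)
turn-sound {d} {a} {π = s ∷ ss} (mkChain refl refl rs ps e) =
  mkChain refl refl (Turn-corner d (advance d 1 a) ∷ rs) (s≤s z≤n ∷ ps) (cong suc e)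

chains-sound : ∀ d a n → All (IsChain d a n) (chains d a n)
chains-sound d a zero    = mkChain refl refl [-] (s≤s z≤n ∷ []) refl ∷ []
chains-sound d a (suc n) = Allₚ.++⁺
  (Allₚ.map⁺ (All.map lengthen-sound (chains-sound d (advance d 1 a) n)))
  (Allₚ.map⁺ (All.map turn-sound (chains-sound (opposite d) (corner d (advance d 1 a)) n)))

chains-complete : ∀ d a n {π} → IsChain d a n π → π ∈ chains d a n
chains-complete d a zero {seg _ _ 1 ∷ []} (mkChain refl refl _ _ _) = here refl
chains-complete d a zero {seg _ _ 1 ∷ seg _ _ (suc _) ∷ _} (mkChain _ _ _ _ ())
chains-complete d a zero {seg _ _ 1 ∷ seg _ _ zero ∷ _} (mkChain _ _ _ (_ ∷ () ∷ _) _)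
chains-complete d a zero {seg _ _ zero ∷ _} (mkChain _ _ _ (() ∷ _) _)
chains-complete d a (suc n) {seg _ _ zero ∷ _} (mkChain _ _ _ (() ∷ _) _)
chains-complete d a (suc n) {seg _ _ 1 ∷ s ∷ ss} (mkChain refl refl (r ∷ rs) (_ ∷ ps) e) =
  let e₁ , e₂ = Turn⁻ d (dir s) (advance d 1 a) (tail s) r in
  ∈-++⁺ʳ _ (∈-map⁺ (seg d a 1 ∷⁺_)
    (chains-complete (opposite d) _ n (mkChain e₁ e₂ rs ps (ℕₚ.suc-injective e))))
chains-complete d a (suc n) {seg _ _ (suc (suc ℓ)) ∷ []} (mkChain refl refl _ _ e) =
  ∈-++⁺ˡ (∈-map⁺ (lengthen d a) (chains-complete d (advance d 1 a) n
    {seg d (advance d 1 a) (suc ℓ) ∷ []}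
    (mkChain refl refl [-] (s≤s z≤n ∷ []) (ℕₚ.suc-injective e))))
chains-complete d a (suc n) {seg _ _ (suc (suc ℓ)) ∷ s ∷ ss} (mkChain refl refl (r ∷ rs) (_ ∷ ps) e) =
  ∈-++⁺ˡ (∈-map⁺ (lengthen d a) (chains-complete d (advance d 1 a) n
    {seg d (advance d 1 a) (suc ℓ) ∷ s ∷ ss}
    (mkChain refl refl
      (subst (λ b → Turn d (dir s) b (tail s)) (sym (advance-suc d (suc ℓ) a)) r ∷ rs)
      (s≤s z≤n ∷ ps) (ℕₚ.suc-injective e))))

lengthen-injective : ∀ {d a b n π π′} → IsChain d b n π → IsChain d b n π′ →
                     lengthen d a π ≡ lengthen d a π′ → π ≡ π′
lengthen-injective {π = seg _ _ _ ∷ _} {seg _ _ _ ∷ _}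
  (mkChain refl refl _ _ _) (mkChain refl refl _ _ _) refl = refl

∷⁺-injective : ∀ {s : Segment} {π π′} → s ∷⁺ π ≡ s ∷⁺ π′ → π ≡ π′
∷⁺-injective {π = _ ∷ _} {_ ∷ _} refl = refl

chains-unique : ∀ d a n → Unique (chains d a n)
chains-unique d a zero    = [] ∷ []
chains-unique d a (suc n) = Unique-++
  {P = λ π → 2 ≤ size (List⁺.head π)} {Q = λ π → size (List⁺.head π) ≡ 1}
  (λ { (s≤s ()) refl })
  (Allₚ.map⁺ (All.map (λ { {_ ∷ _} (mkChain _ _ _ (p ∷ _) _) → s≤s p }) (chains-sound d _ n)))
  (Allₚ.map⁺ (All.universal (λ _ → refl) _))
  (Unique-map (lengthen d a) lengthen-injective (chains-sound d _ n) (chains-unique d _ n))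
  (Uniqueₚ.map⁺ ∷⁺-injective (chains-unique (opposite d) _ n))

chain⇒path : ∀ {d a n π} → IsChain d (retreat d a) n π → IsStairPath (suc n) a π
chain⇒path {d} {a} (mkChain refl refl rs ps e) = record
  { second-point = advance-retreat d a ; turns = rs ; positive = ps ; total = e }

path⇒chain : ∀ {a n π} → IsStairPath (suc n) a π →
             IsChain (dir (List⁺.head π)) (retreat (dir (List⁺.head π)) a) n π
path⇒chain {π = s ∷ ss} record { second-point = refl ; turns = rs ; positive = ps ; total = e } =
  mkChain refl (sym (retreat-advance (dir s) (tail s))) rs ps e

stairPaths : ∀ n a → Enumeration (IsStairPath n a)
stairPaths zero a = record
  { elements = [] ; unique = [] ; sound = []
  ; complete = λ { {seg _ _ zero ∷ _} record { positive = () ∷ _ }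
                 ; {seg _ _ (suc _) ∷ _} record { total = () } } }
stairPaths (suc n) a = record
  { elements = R ++ D
  ; unique   = Unique-++ {P = λ π → dir (List⁺.head π) ≡ right} {Q = λ π → dir (List⁺.head π) ≡ down}
                 (λ { e f → contradiction (trans (sym e) f) λ () })
                 (All.map IsChain.isDir R-sound) (All.map IsChain.isDir D-sound)
                 (chains-unique right _ n) (chains-unique down _ n)
  ; sound    = Allₚ.++⁺ (All.map chain⇒path R-sound) (All.map chain⇒path D-sound)
  ; complete = λ { {seg right _ _ ∷ _} p → ∈-++⁺ˡ (chains-complete right _ n (path⇒chain p))
                 ; {seg down  _ _ ∷ _} p → ∈-++⁺ʳ R (chains-complete down _ n (path⇒chain p)) }
  }
  where
  R = chains right (retreat right a) n
  D = chains down (retreat down a) n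
  R-sound = chains-sound right (retreat right a) n
  D-sound = chains-sound down (retreat down a) n

------------------------------------------------------------------------
-- The explicit formula.  Its index is the nonempty list
-- (r₁ , d₁) ∷ ⋯ ∷ (r_k , d_k) ∷ [].

Lengths : Set
Lengths = List⁺ (ℕ × ℕ)

rs ds : Lengths → List ℕ
rs w = map proj₁ (toList w)
ds w = map proj₂ (toList w)

-- r₁ and d_k may vanish, all other entries are at least 1.
record IsLengths (n : ℕ) (w : Lengths) : Set where
  constructor mkLengths
  field
    r-positive : All (1 ≤_) (drop 1 (rs w))
    d-positive : All (1 ≤_) (take (List⁺.length w ℕ.∸ 1) (ds w))
    total      : sum (rs w) ℕ.+ sum (ds w) ≡ n

-- Σr w v = r₁ + ⋯ + r_v and Σd w v = d₁ + ⋯ + d_v.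
Σr Σd : Lengths → ℕ → ℤ
Σr w v = + sum (take v (rs w))
Σd w v = + sum (take v (ds w))

-- The factor of ∏< with index v is the one the formula indexes by v + 1.
term : Point → Lengths → RatFun
term (i , j) w =
  x (i + Σr w k , j - Σd w k) ⊗
  ∏< k λ v →
    (x (i - 1ℤ + Σr w v , j - Σd w v) ÷ x (i - 1ℤ + Σr w (suc v) , j - Σd w v)) ⊗
    (x (i + Σr w (suc v) , j + 1ℤ - Σd w v) ÷ x (i + Σr w (suc v) , j + 1ℤ - Σd w (suc v)))
  where
  k = List⁺.length w

stepRight stepDown : Lengths → Lengths
stepRight ((r , d) ∷ ps)     = (suc r , d) ∷ ps
stepDown  ((zero , d) ∷ ps)  = (zero , suc d) ∷ ps
stepDown  ((suc r , d) ∷ ps) = (zero , 1) ∷ (suc r , d) ∷ ps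

allLengths : ℕ → List Lengths
allLengths zero    = [ (zero , zero) ∷ [] ]
allLengths (suc n) = map stepRight (allLengths n) ++ map stepDown (allLengths n)

stepRight-sound : ∀ {n w} → IsLengths n w → IsLengths (suc n) (stepRight w)
stepRight-sound {w = _ ∷ []}    (mkLengths rp dp e) = mkLengths rp dp (cong suc e)
stepRight-sound {w = _ ∷ _ ∷ _} (mkLengths rp dp e) = mkLengths rp dp (cong suc e)

stepDown-sound : ∀ {n w} → IsLengths n w → IsLengths (suc n) (stepDown w)
stepDown-sound {w = (zero , d) ∷ []} (mkLengths rp dp e) = mkLengths rp [] (cong suc e)
stepDown-sound {w = (zero , d) ∷ p ∷ ps} (mkLengths rp (_ ∷ dp) e) =
  mkLengths rp (s≤s z≤n ∷ dp) (trans (ℕₚ.+-suc (sum (map proj₁ (p ∷ ps))) _) (cong suc e))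
stepDown-sound {w = (suc r , d) ∷ ps} (mkLengths rp dp e) =
  mkLengths (s≤s z≤n ∷ rp) (s≤s z≤n ∷ dp) (trans (ℕₚ.+-suc (sum (rs ((suc r , d) ∷ ps))) _) (cong suc e))

allLengths-sound : ∀ n → All (IsLengths n) (allLengths n)
allLengths-sound zero    = mkLengths [] [] refl ∷ []
allLengths-sound (suc n) = Allₚ.++⁺
  (Allₚ.map⁺ (All.map stepRight-sound (allLengths-sound n)))
  (Allₚ.map⁺ (All.map stepDown-sound (allLengths-sound n)))

sum-suc : ∀ m k {n} → m ℕ.+ suc k ≡ suc n → m ℕ.+ k ≡ n
sum-suc m k e = ℕₚ.suc-injective (trans (sym (ℕₚ.+-suc m k)) e)

allLengths-complete : ∀ n {w} → IsLengths n w → w ∈ allLengths n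
allLengths-complete zero {(zero , zero) ∷ []} _ = here refl
allLengths-complete zero {(zero , zero) ∷ _ ∷ _} (mkLengths _ (() ∷ _) _)
allLengths-complete zero {(zero , suc d) ∷ []} (mkLengths _ _ ())
allLengths-complete zero {(zero , suc d) ∷ (zero , _) ∷ _} (mkLengths (() ∷ _) _ _)
allLengths-complete zero {(zero , suc d) ∷ (suc _ , _) ∷ _} (mkLengths _ _ ())
allLengths-complete zero {(suc r , d) ∷ _} (mkLengths _ _ ())
allLengths-complete (suc n) {(suc r , d) ∷ ps} (mkLengths rp dp e) =
  ∈-++⁺ˡ (∈-map⁺ stepRight (allLengths-complete n {(r , d) ∷ ps}
    (mkLengths rp dp (ℕₚ.suc-injective e))))
allLengths-complete (suc n) {(zero , zero) ∷ []} (mkLengths _ _ ())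
allLengths-complete (suc n) {(zero , zero) ∷ _ ∷ _} (mkLengths _ (() ∷ _) _)
allLengths-complete (suc n) {(zero , suc d) ∷ []} (mkLengths rp dp e) =
  ∈-++⁺ʳ _ (∈-map⁺ stepDown (allLengths-complete n {(zero , d) ∷ []}
    (mkLengths [] [] (ℕₚ.suc-injective e))))
allLengths-complete (suc n) {(zero , suc d) ∷ (zero , _) ∷ _} (mkLengths (() ∷ _) _ _)
allLengths-complete (suc n) {(zero , suc zero) ∷ (suc r , d) ∷ ps} (mkLengths (_ ∷ rp) (_ ∷ dp) e) =
  ∈-++⁺ʳ _ (∈-map⁺ stepDown (allLengths-complete n {(suc r , d) ∷ ps}
    (mkLengths rp dp (sum-suc (sum (rs ((suc r , d) ∷ ps))) _ e))))
allLengths-complete (suc n) {(zero , suc (suc d)) ∷ (suc r , d′) ∷ ps} (mkLengths rp (_ ∷ dp) e) =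
  ∈-++⁺ʳ _ (∈-map⁺ stepDown (allLengths-complete n {(zero , suc d) ∷ (suc r , d′) ∷ ps}
    (mkLengths rp (s≤s z≤n ∷ dp) (sum-suc (sum (rs ((suc r , d′) ∷ ps))) _ e))))

stepRight-injective : ∀ {w w′} → stepRight w ≡ stepRight w′ → w ≡ w′
stepRight-injective {_ ∷ _} {_ ∷ _} refl = refl

stepDown-injective : ∀ {n w w′} → IsLengths n w → IsLengths n w′ →
                     stepDown w ≡ stepDown w′ → w ≡ w′
stepDown-injective {w = (zero , _) ∷ _} {(zero , _) ∷ _} _ _ refl = refl
stepDown-injective {w = (suc _ , _) ∷ _} {(suc _ , _) ∷ _} _ _ refl = refl
stepDown-injective {w = (zero , _) ∷ _} {(suc _ , _) ∷ _} (mkLengths _ (() ∷ _) _) _ refl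
stepDown-injective {w = (suc _ , _) ∷ _} {(zero , _) ∷ _} _ (mkLengths _ (() ∷ _) _) refl

stepDown-zero : ∀ w → proj₁ (List⁺.head (stepDown w)) ≡ 0
stepDown-zero ((zero , _) ∷ _)  = refl
stepDown-zero ((suc _ , _) ∷ _) = refl

allLengths-unique : ∀ n → Unique (allLengths n)
allLengths-unique zero    = [] ∷ []
allLengths-unique (suc n) = Unique-++
  {P = λ w → proj₁ (List⁺.head w) ≢ 0} {Q = λ w → proj₁ (List⁺.head w) ≡ 0}
  (λ p q → p q)
  (Allₚ.map⁺ (All.universal (λ { (_ ∷ _) () }) _))
  (Allₚ.map⁺ (All.universal stepDown-zero _))
  (Uniqueₚ.map⁺ stepRight-injective (allLengths-unique n))
  (Unique-map stepDown stepDown-injective (allLengths-sound n) (allLengths-unique n))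

lengths : ∀ n → Enumeration (IsLengths n)
lengths n = record
  { elements = allLengths n
  ; unique   = allLengths-unique n
  ; sound    = allLengths-sound n
  ; complete = allLengths-complete n
  }

{-# OPTIONS --safe #-}
module Submission where

-- On the diagonal the recursion for ψ becomes linear:
--   ψ_{n+1,n+1}(i,j) = x_{i-1,j}/x_{i,j} · ψ_{n,n}(i+1,j) + x_{i,j+1}/x_{i,j} · ψ_{n,n}(i,j-1).
-- Splitting off the first unit step of a path, or of an index of the explicit
-- formula, yields the same recursion for both sums: the quotient in front is
-- the factor contributed by a unit step to the right, respectively down, and
-- the quotients telescope along each segment.

open import Defs
open import Algebra.Bundles using (CommutativeSemiring; CommutativeRing)
open import Algebra.Structures.Biased using (isCommutativeSemiringˡ)
import Algebra.Solver.Ring.NaturalCoefficients.Default as NaturalCoefficients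
open import Data.Integer.Base using (ℤ; 0ℤ; 1ℤ; _+_; _-_)
import Data.Integer.Properties as ℤₚ
import Data.Integer.Tactic.RingSolver as ℤ-Solver
open import Data.List.Base using (List; []; _∷_; _++_; foldr; length; map)
open import Data.List.NonEmpty.Base using (_∷_; _∷⁺_)
open import Data.List.Relation.Unary.All as All using (All; []; _∷_)
open import Data.Nat.Base using (ℕ; zero; suc; _≤_)
import Data.Nat.Properties as ℕₚ
open import Data.Product.Base using (_×_; _,_)
open import Level using (0ℓ)
open import Relation.Binary.PropositionalEquality using (_≡_; refl; sym; trans; cong; cong₂)
import Relation.Binary.Reasoning.Setoid as SetoidReasoning
open import Relation.Binary.Structures using (IsEquivalence)

open NaturalCoefficients (CommutativeRing.commutativeSemiring Poly-commutativeRing)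
  using (solve; _:=_; _:+_; _:*_; con)

-- Fractions as a commutative semiring.

1ₚ-nonZero : NonZeroₚ 1ₚ
1ₚ-nonZero = (λ _ → 1ℤ) , λ ()

-- f ≃ g unfolds to a statement from which f and g cannot be inferred; wrapped
-- in a record it can serve as the equality of an algebraic bundle.
infix 4 _≋_
record _≋_ (f g : RatFun) : Set where
  constructor wrap
  field
    unwrap : f ≃ g

open _≋_

cross : ∀ {f g} → num f *ₚ den g ≈ₚ num g *ₚ den f → f ≋ g
cross e = wrap (1ₚ , 1ₚ-nonZero , *-cong ≈-refl e)

≋-refl : ∀ {f} → f ≋ f
≋-refl = cross ≈-refl

≋-sym : ∀ {f g} → f ≋ g → g ≋ f
≋-sym (wrap (s , s≢0 , e)) = wrap (s , s≢0 , ≈-sym e)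

≋-trans : ∀ {f g h} → f ≋ g → g ≋ h → f ≋ h
≋-trans {f} {g} {h} (wrap (s , s≢0 , e)) (wrap (t , t≢0 , e′)) = wrap (
  -- The factor `den g` lets the two hypotheses be used one after the other: `e` trades
  -- `num f *ₚ den g` for `num g *ₚ den f`, and `e′` then trades `num g *ₚ den h` for
  -- `num h *ₚ den g`.
  s *ₚ t *ₚ den g , NonZeroₚ-* (s *ₚ t) (den g) (NonZeroₚ-* s t s≢0 t≢0) (den≢0 g) ,
  ≈-trans (solve 5 (λ s t g a h → s :* t :* g :* (a :* h) := t :* h :* (s :* (a :* g)))
             ≈-refl s t (den g) (num f) (den h))
  (≈-trans (*-cong ≈-refl e)
  (≈-trans (solve 5 (λ s t h b f → t :* h :* (s :* (b :* f)) := s :* f :* (t :* (b :* h)))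
             ≈-refl s t (den h) (num g) (den f))
  (≈-trans (*-cong ≈-refl e′)
  (solve 5 (λ s t f c g → s :* f :* (t :* (c :* g)) := s :* t :* g :* (c :* f))
             ≈-refl s t (den f) (num h) (den g))))))

⊗-cong : ∀ {f f′ g g′} → f ≋ f′ → g ≋ g′ → f ⊗ g ≋ f′ ⊗ g′
⊗-cong {f} {f′} {g} {g′} (wrap (s , s≢0 , e)) (wrap (t , t≢0 , e′)) = wrap (
  s *ₚ t , NonZeroₚ-* s t s≢0 t≢0 ,
  ≈-trans (regroup s t (num f) (den f′) (num g) (den g′))
  (≈-trans (*-cong e e′) (≈-sym (regroup s t (num f′) (den f) (num g′) (den g)))))
  where
  regroup : ∀ s t a b c d → s *ₚ t *ₚ (a *ₚ c *ₚ (b *ₚ d)) ≈ₚ s *ₚ (a *ₚ b) *ₚ (t *ₚ (c *ₚ d))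
  regroup = solve 6 (λ s t a b c d → s :* t :* (a :* c :* (b :* d)) := s :* (a :* b) :* (t :* (c :* d))) ≈-refl

⊕-cong : ∀ {f f′ g g′} → f ≋ f′ → g ≋ g′ → f ⊕ g ≋ f′ ⊕ g′
⊕-cong {f} {f′} {g} {g′} (wrap (s , s≢0 , e)) (wrap (t , t≢0 , e′)) = wrap (
  s *ₚ t , NonZeroₚ-* s t s≢0 t≢0 ,
  ≈-trans (regroup s t (num f) (num g) (den f) (den g) (den f′) (den g′))
  (≈-trans (+-cong (*-cong ≈-refl e) (*-cong ≈-refl e′))
  (solve 8 (λ s t a b c d c′ d′ →
      t :* d :* d′ :* (s :* (a :* c)) :+ s :* c :* c′ :* (t :* (b :* d))
        := s :* t :* ((a :* d′ :+ b :* c′) :* (c :* d)))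
    ≈-refl s t (num f′) (num g′) (den f) (den g) (den f′) (den g′))))
  where
  regroup : ∀ s t a b c d c′ d′ → s *ₚ t *ₚ ((a *ₚ d +ₚ b *ₚ c) *ₚ (c′ *ₚ d′)) ≈ₚ
            t *ₚ d *ₚ d′ *ₚ (s *ₚ (a *ₚ c′)) +ₚ s *ₚ c *ₚ c′ *ₚ (t *ₚ (b *ₚ d′))
  regroup = solve 8 (λ s t a b c d c′ d′ → s :* t :* ((a :* d :+ b :* c) :* (c′ :* d′)) :=
            t :* d :* d′ :* (s :* (a :* c′)) :+ s :* c :* c′ :* (t :* (b :* d′))) ≈-refl

-- Supplies the solver `solveᵣ` and the equational reasoning for sums of weights. The unit,
-- associative, commutative and distributive laws are polynomial identities after
-- cross-multiplication.
RatFun-commutativeSemiring : CommutativeSemiring 0ℓ 0ℓ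
RatFun-commutativeSemiring = record
  { Carrier = RatFun ; _≈_ = _≋_ ; _+_ = _⊕_ ; _*_ = _⊗_ ; 0# = 0ᵣ ; 1# = 1ᵣ
  ; isCommutativeSemiring = isCommutativeSemiringˡ record
    { +-isCommutativeMonoid = record
      { isMonoid = record
        { isSemigroup = record
          { isMagma = record { isEquivalence = ≋-isEquivalence ; ∙-cong = ⊕-cong }
          ; assoc = λ f g h → cross (solve 6 (λ a b c d e k →
              ((a :* d :+ c :* b) :* k :+ e :* (b :* d)) :* (b :* (d :* k)) :=
              (a :* (d :* k) :+ (c :* k :+ e :* d) :* b) :* (b :* d :* k))
              ≈-refl (num f) (den f) (num g) (den g) (num h) (den h)) }
        ; identity =
            (λ f → cross (solve 2 (λ a b → (con 0 :* b :+ a :* con 1) :* b := a :* (con 1 :* b))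
                            ≈-refl (num f) (den f)))
          , (λ f → cross (solve 2 (λ a b → (a :* con 1 :+ con 0 :* b) :* b := a :* (b :* con 1))
                            ≈-refl (num f) (den f))) }
      ; comm = λ f g → cross (solve 4 (λ a b c d →
          (a :* d :+ c :* b) :* (d :* b) := (c :* b :+ a :* d) :* (b :* d))
          ≈-refl (num f) (den f) (num g) (den g)) }
    ; *-isCommutativeMonoid = record
      { isMonoid = record
        { isSemigroup = record
          { isMagma = record { isEquivalence = ≋-isEquivalence ; ∙-cong = ⊗-cong }
          ; assoc = λ f g h → cross (*-cong (*-assoc _ _ _) (≈-sym (*-assoc _ _ _))) }
        ; identity =
            (λ f → cross (solve 2 (λ a b → con 1 :* a :* b := a :* (con 1 :* b))
                            ≈-refl (num f) (den f)))
          , (λ f → cross (solve 2 (λ a b → a :* con 1 :* b := a :* (b :* con 1))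
                            ≈-refl (num f) (den f))) }
      ; comm = λ f g → cross (*-cong (*-comm _ _) (*-comm _ _)) }
    ; distribʳ = λ h f g → cross (solve 6 (λ a b c d e k →
        (a :* d :+ c :* b) :* e :* (b :* k :* (d :* k)) :=
        (a :* e :* (d :* k) :+ c :* e :* (b :* k)) :* (b :* d :* k))
        ≈-refl (num f) (den f) (num g) (den g) (num h) (den h))
    ; zeroˡ = λ f → cross (solve 2 (λ a b → con 0 :* a :* con 1 := con 0 :* (con 1 :* b))
        ≈-refl (num f) (den f)) } }
  where
  ≋-isEquivalence : IsEquivalence _≋_
  ≋-isEquivalence = record { refl = ≋-refl ; sym = ≋-sym ; trans = ≋-trans }

open NaturalCoefficients RatFun-commutativeSemiring
  using () renaming (solve to solveᵣ; _:=_ to infix 4 _≔_; _:+_ to infixl 6 _∔_; _:*_ to infixl 7 _∗_)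
open SetoidReasoning (CommutativeSemiring.setoid RatFun-commutativeSemiring)
open CommutativeSemiring RatFun-commutativeSemiring using ()
  renaming ( reflexive to ≋-reflexive; +-comm to ⊕-comm; +-assoc to ⊕-assoc
           ; +-identityˡ to ⊕-identityˡ; +-identityʳ to ⊕-identityʳ
           ; *-assoc to ⊗-assoc; *-identityˡ to ⊗-identityˡ; *-identityʳ to ⊗-identityʳ
           ; distribˡ to ⊗-distribˡ-⊕; zeroʳ to ⊗-zeroʳ )

-- Quotients and the recursion along the diagonal.

÷-inverse : ∀ f g (p q : NonZeroᵣ g) → _÷_ f g ⦃ p ⦄ ≋ f ⊗ _÷_ 1ᵣ g ⦃ q ⦄
÷-inverse f g p q = cross (solve 4 (λ a b c d →
  a :* d :* (b :* (con 1 :* c)) := a :* (con 1 :* d) :* (b :* c))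
  ≈-refl (num f) (den f) (num g) (den g))

-- The numerator has the shape of the recursion for `ψ`, with boundary values `f` and `f′` on the
-- outside. Two witnesses for `h` are allowed because `ψ` divides by a proof from positivity and
-- weights by `x-nonZero`; numerators and denominators do not depend on the choice.
÷-⊕ : ∀ f f′ g g′ h (p q : NonZeroᵣ h) →
      _÷_ (f ⊗ g ⊕ g′ ⊗ f′) h ⦃ p ⦄ ≋ _÷_ f h ⦃ q ⦄ ⊗ g ⊕ _÷_ f′ h ⦃ q ⦄ ⊗ g′
÷-⊕ f f′ g g′ h p q = begin
  _÷_ (f ⊗ g ⊕ g′ ⊗ f′) h ⦃ p ⦄            ≈⟨ ÷-inverse (f ⊗ g ⊕ g′ ⊗ f′) h p q ⟩
  (f ⊗ g ⊕ g′ ⊗ f′) ⊗ h⁻¹                  ≈⟨ distribute f f′ g g′ h⁻¹ ⟩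
  f ⊗ h⁻¹ ⊗ g ⊕ f′ ⊗ h⁻¹ ⊗ g′              ≈⟨ ⊕-cong (⊗-cong (÷-inverse f h q q) ≋-refl)
                                                      (⊗-cong (÷-inverse f′ h q q) ≋-refl) ⟨
  _÷_ f h ⦃ q ⦄ ⊗ g ⊕ _÷_ f′ h ⦃ q ⦄ ⊗ g′  ∎
  where
  h⁻¹ = _÷_ 1ᵣ h ⦃ q ⦄
  distribute : ∀ f f′ g g′ k → (f ⊗ g ⊕ g′ ⊗ f′) ⊗ k ≋ f ⊗ k ⊗ g ⊕ f′ ⊗ k ⊗ g′
  distribute = solveᵣ 5 (λ f f′ g g′ k → (f ∗ g ∔ g′ ∗ f′) ∗ k ≔ f ∗ k ∗ g ∔ f′ ∗ k ∗ g′) ≋-refl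

x÷x : ∀ a → x a ÷ x a ≋ 1ᵣ
x÷x a = cross (solve 1 (λ u → u :* con 1 :* con 1 := con 1 :* (con 1 :* u)) ≈-refl (var a))

÷-telescope : ∀ a b c → x a ÷ x c ≋ (x a ÷ x b) ⊗ (x b ÷ x c)
÷-telescope a b c = cross (solve 3 (λ u v w →
  u :* con 1 :* (con 1 :* v :* (con 1 :* w)) := u :* con 1 :* (v :* con 1) :* (con 1 :* w))
  ≈-refl (var a) (var b) (var c))

-- With t = k + 1 two of the four values of ψ in the numerator, and the
-- denominator, are on the boundary: along the diagonal the recursion is linear.
ψ-diagonal : ∀ n i j → ψ (suc n) (suc n) (i , j) ≋
  (x (i - 1ℤ , j) ÷ x (i , j)) ⊗ ψ n n (i + 1ℤ , j) ⊕
  (x (i , j + 1ℤ) ÷ x (i , j)) ⊗ ψ n n (i , j - 1ℤ)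
ψ-diagonal zero i j =
  ÷-⊕ (x (i - 1ℤ , j)) (x (i , j + 1ℤ)) (x (i + 1ℤ , j)) (x (i , j - 1ℤ)) (x (i , j)) _ (x-nonZero {i , j})
ψ-diagonal (suc k) i j
  rewrite ψ⁺-step k (suc k) i j ℕₚ.≤-refl
        | ψ⁺-top (suc k) (i - 1ℤ) j | ψ⁺-top (suc k) i (j + 1ℤ) | ψ⁺-top k i j =
  ÷-⊕ (x (i - 1ℤ , j)) (x (i , j + 1ℤ)) (ψ (suc k) (suc k) (i + 1ℤ , j)) (ψ (suc k) (suc k) (i , j - 1ℤ))
      (x (i , j)) _ (x-nonZero {i , j})

-- Finite sums and products.

∑ₗ : ∀ {A : Set} → (A → RatFun) → List A → RatFun
∑ₗ f as = foldr _⊕_ 0ᵣ (map f as)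

∑ₗ-++ : ∀ {A : Set} (f : A → RatFun) as bs → ∑ₗ f (as ++ bs) ≋ ∑ₗ f as ⊕ ∑ₗ f bs
∑ₗ-++ f []       bs = ≋-sym (⊕-identityˡ (∑ₗ f bs))
∑ₗ-++ f (a ∷ as) bs = ≋-trans (⊕-cong ≋-refl (∑ₗ-++ f as bs)) (≋-sym (⊕-assoc (f a) (∑ₗ f as) (∑ₗ f bs)))

-- The hypothesis is restricted to the entries of the list because `weight-lengthen` is available
-- only for chains.
∑ₗ-map : ∀ {A B : Set} {f : B → RatFun} {g : A → B} {c} {h : A → RatFun} {as} →
         All (λ a → f (g a) ≋ c ⊗ h a) as → ∑ₗ f (map g as) ≋ c ⊗ ∑ₗ h as
∑ₗ-map {c = c} [] = ≋-sym (⊗-zeroʳ c)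
∑ₗ-map {c = c} (e ∷ es) = ≋-trans (⊕-cong e (∑ₗ-map es))
  (≋-sym (⊗-distribˡ-⊕ c _ _))

∏<-cong : ∀ k {f g} → (∀ v → f v ≡ g v) → ∏< k f ≡ ∏< k g
∏<-cong zero    f≗g = refl
∏<-cong (suc k) f≗g = cong₂ _⊗_ (f≗g 0) (∏<-cong k λ v → f≗g (suc v))

-- Reversed-stair paths

endpoint-lengthen : ∀ d a ℓ ss →
  endpoint (seg d a (suc ℓ) ∷ ss) ≡ endpoint (seg d (advance d 1 a) ℓ ∷ ss)
endpoint-lengthen d a ℓ []      = cong (advance d 1) (sym (advance-suc d ℓ a))
endpoint-lengthen d a ℓ (_ ∷ _) = refl

-- Lengthening moves the tail of the first segment back and keeps its head, so its quotient
-- telescopes through the old tail.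
weight-lengthen : ∀ {d a n π} → IsChain d (advance d 1 a) n π →
                  weight (lengthen d a π) ≋ (x a ÷ x (advance d 1 a)) ⊗ weight π
weight-lengthen {d} {a} {π = seg _ _ ℓ ∷ ss} (mkChain refl refl _ _ _)
  rewrite endpoint-lengthen d a ℓ ss | advance-suc d ℓ a = begin
  (x a ÷ x c) ⊗ W ⊗ E                ≈⟨ ⊗-cong (⊗-cong (÷-telescope a b c) ≋-refl) ≋-refl ⟩
  (x a ÷ x b) ⊗ (x b ÷ x c) ⊗ W ⊗ E  ≈⟨ regroup (x a ÷ x b) (x b ÷ x c) W E ⟩
  (x a ÷ x b) ⊗ ((x b ÷ x c) ⊗ W ⊗ E) ∎
  where
  b = advance d 1 a
  c = advance d (suc ℓ) a
  W = foldr _⊗_ 1ᵣ (map (λ s → x (tail s) ÷ x (head s)) ss)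
  E = x (endpoint (seg d b ℓ ∷ ss))
  regroup : ∀ p q w e → p ⊗ q ⊗ w ⊗ e ≋ p ⊗ (q ⊗ w ⊗ e)
  regroup = solveᵣ 4 (λ p q w e → p ∗ q ∗ w ∗ e ≔ p ∗ (q ∗ w ∗ e)) ≋-refl

weight-turn : ∀ d a π → weight (seg d a 1 ∷⁺ π) ≋ (x a ÷ x (advance d 1 a)) ⊗ weight π
weight-turn d a π@(_ ∷ _) = ⊗-assoc (x a ÷ x (advance d 1 a)) _ _

-- The paths of length n + 1 only: n counts the unit steps after the first.
branch : ℕ → Direction → Point → RatFun
branch n d a = ∑ₗ weight (chains d (retreat d a) n)

-- The diagonal shift at a corner is exactly what makes the remaining path a reversed-stair path of
-- the next lattice point, the same point as when the segment goes straight on.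
corner-retreat : ∀ d a → corner d a ≡ retreat (opposite d) (advance d 1 a)
corner-retreat right a = refl
corner-retreat down  a = refl

branch-zero : ∀ d a → branch 0 d a ≋ (x (retreat d a) ÷ x a) ⊗ x (advance d 1 a)
branch-zero d a rewrite advance-retreat d a =
  ≋-trans (⊕-identityʳ _) (⊗-cong (⊗-identityʳ _) ≋-refl)

branch-suc : ∀ n d a → branch (suc n) d a ≋
  (x (retreat d a) ÷ x a) ⊗ (branch n d (advance d 1 a) ⊕ branch n (opposite d) (advance d 1 a))
branch-suc n d a = begin
  ∑ₗ weight (map (lengthen d b) L ++ map (seg d b 1 ∷⁺_) T)
    ≈⟨ ∑ₗ-++ weight (map (lengthen d b) L) (map (seg d b 1 ∷⁺_) T) ⟩
  ∑ₗ weight (map (lengthen d b) L) ⊕ ∑ₗ weight (map (seg d b 1 ∷⁺_) T)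
    ≈⟨ ⊕-cong (∑ₗ-map (All.map weight-lengthen (chains-sound d (advance d 1 b) n)))
              (∑ₗ-map (All.universal (weight-turn d b) T)) ⟩
  c ⊗ ∑ₗ weight L ⊕ c ⊗ ∑ₗ weight T
    ≈⟨ ⊗-distribˡ-⊕ c (∑ₗ weight L) (∑ₗ weight T) ⟨
  c ⊗ (∑ₗ weight L ⊕ ∑ₗ weight T)
    -- The head of the first unit step occurs in two roles: as `a` in the quotient and the corner,
    -- and as `retreat d (advance d 1 a)` where the segment continues.
    ≡⟨ cong₂ (λ p q → (x b ÷ x p) ⊗ (∑ₗ weight (chains d q n) ⊕ ∑ₗ weight (chains (opposite d) (corner d p) n)))
             (advance-retreat d a) (trans (advance-retreat d a) (sym (retreat-advance d a))) ⟩
  (x b ÷ x a) ⊗ (branch n d (advance d 1 a) ⊕ ∑ₗ weight (chains (opposite d) (corner d a) n))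
    ≡⟨ cong (λ q → (x b ÷ x a) ⊗ (branch n d (advance d 1 a) ⊕ ∑ₗ weight (chains (opposite d) q n)))
            (corner-retreat d a) ⟩
  (x b ÷ x a) ⊗ (branch n d (advance d 1 a) ⊕ branch n (opposite d) (advance d 1 a)) ∎
  where
  b = retreat d a
  L = chains d (advance d 1 b) n
  T = chains (opposite d) (corner d (advance d 1 b)) n
  c = x b ÷ x (advance d 1 b)

ψ-branches : ∀ n i j → ψ (suc n) (suc n) (i , j) ≋ branch n right (i , j) ⊕ branch n down (i , j)
ψ-branches zero i j = ≋-trans (ψ-diagonal 0 i j)
  (≋-sym (⊕-cong (branch-zero right (i , j)) (branch-zero down (i , j))))
ψ-branches (suc n) i j = begin
  ψ (suc (suc n)) (suc (suc n)) (i , j)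
    ≈⟨ ψ-diagonal (suc n) i j ⟩
  c ⊗ ψ (suc n) (suc n) (i + 1ℤ , j) ⊕ c′ ⊗ ψ (suc n) (suc n) (i , j - 1ℤ)
    ≈⟨ ⊕-cong (⊗-cong ≋-refl (ψ-branches n (i + 1ℤ) j))
              -- `branch-suc` puts the continued direction first, so the summands are swapped after
              -- a step down.
              (⊗-cong ≋-refl (≋-trans (ψ-branches n i (j - 1ℤ))
                (⊕-comm (branch n right (i , j - 1ℤ)) (branch n down (i , j - 1ℤ))))) ⟩
  c ⊗ (branch n right (i + 1ℤ , j) ⊕ branch n down (i + 1ℤ , j)) ⊕
  c′ ⊗ (branch n down (i , j - 1ℤ) ⊕ branch n right (i , j - 1ℤ))
    ≈⟨ ⊕-cong (branch-suc n right (i , j)) (branch-suc n down (i , j)) ⟨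
  branch (suc n) right (i , j) ⊕ branch (suc n) down (i , j) ∎
  where
  c  = x (i - 1ℤ , j) ÷ x (i , j)
  c′ = x (i , j + 1ℤ) ÷ x (i , j)

-- The explicit formula

-- One factor of the explicit product, with the partial sums before and after it replaced by
-- arbitrary integers, so that translations become ring identities.
stair : (i j r d r′ d′ : ℤ) → RatFun
stair i j r d r′ d′ =
  (x (i - 1ℤ + r , j - d) ÷ x (i - 1ℤ + r′ , j - d)) ⊗
  (x (i + r′ , j + 1ℤ - d) ÷ x (i + r′ , j + 1ℤ - d′))

right-shift : ∀ i r → i + (1ℤ + r) ≡ i + 1ℤ + r
right-shift = ℤ-Solver.solve-∀

right-shift⁻ : ∀ i r → i - 1ℤ + (1ℤ + r) ≡ i + 1ℤ - 1ℤ + r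
right-shift⁻ = ℤ-Solver.solve-∀

down-shift : ∀ j d → j - (1ℤ + d) ≡ j - 1ℤ - d
down-shift = ℤ-Solver.solve-∀

down-shift⁺ : ∀ j d → j + 1ℤ - (1ℤ + d) ≡ j - 1ℤ + 1ℤ - d
down-shift⁺ = ℤ-Solver.solve-∀

stair-right : ∀ i j r d r′ d′ → stair i j (1ℤ + r) d (1ℤ + r′) d′ ≡ stair (i + 1ℤ) j r d r′ d′
stair-right i j r d r′ d′
  rewrite right-shift⁻ i r | right-shift⁻ i r′ | right-shift i r′ = refl

stair-down : ∀ i j r d r′ d′ → stair i j r (1ℤ + d) r′ (1ℤ + d′) ≡ stair i (j - 1ℤ) r d r′ d′
stair-down i j r d r′ d′
  rewrite down-shift j d | down-shift⁺ j d | down-shift⁺ j d′ = refl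

-- In the first factor the empty partial sums stay 0 while the next one grows. The horizontal tail
-- is therefore not translated, and telescoping through `(i , j)` produces the extra quotient.
stair-right-first : ∀ i j r d →
  stair i j 0ℤ 0ℤ (1ℤ + r) d ≋ (x (i - 1ℤ , j) ÷ x (i , j)) ⊗ stair (i + 1ℤ) j 0ℤ 0ℤ r d
stair-right-first i j r d
  rewrite right-shift⁻ i r | right-shift i r | ℤₚ.+-identityʳ (i - 1ℤ) | ℤₚ.+-identityʳ j
        | ℤₚ.+-identityʳ (i + 1ℤ - 1ℤ) = begin
  (x (i - 1ℤ , j) ÷ x c) ⊗ s
    ≈⟨ ⊗-cong (÷-telescope (i - 1ℤ , j) (i , j) c) ≋-refl ⟩
  (x (i - 1ℤ , j) ÷ x (i , j)) ⊗ (x (i , j) ÷ x c) ⊗ s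
    ≈⟨ ⊗-assoc (x (i - 1ℤ , j) ÷ x (i , j)) (x (i , j) ÷ x c) s ⟩
  (x (i - 1ℤ , j) ÷ x (i , j)) ⊗ ((x (i , j) ÷ x c) ⊗ s)
    ≡⟨ cong (λ k → (x (i - 1ℤ , j) ÷ x (i , j)) ⊗ ((x (k , j) ÷ x c) ⊗ s)) (lemma i) ⟩
  (x (i - 1ℤ , j) ÷ x (i , j)) ⊗ ((x (i + 1ℤ - 1ℤ , j) ÷ x c) ⊗ s) ∎
  where
  lemma : ∀ i → i ≡ i + 1ℤ - 1ℤ
  lemma = ℤ-Solver.solve-∀
  c = (i + 1ℤ - 1ℤ + r , j)
  s = x (i + 1ℤ + r , j + 1ℤ - 0ℤ) ÷ x (i + 1ℤ + r , j + 1ℤ - d)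

stair-down-only : ∀ i j d → stair i j 0ℤ 0ℤ 0ℤ d ≋ x (i , j + 1ℤ) ÷ x (i , j + 1ℤ - d)
stair-down-only i j d
  rewrite ℤₚ.+-identityʳ i | ℤₚ.+-identityʳ (j + 1ℤ) =
  ≋-trans (⊗-cong (x÷x (i - 1ℤ + 0ℤ , j - 0ℤ)) ≋-refl) (⊗-identityˡ (x (i , j + 1ℤ) ÷ x (i , j + 1ℤ - d)))

-- With no horizontal length the horizontal quotient is 1; the vertical one telescopes through
-- `(i , j)`.
stair-down-first : ∀ i j d →
  stair i j 0ℤ 0ℤ 0ℤ (1ℤ + d) ≋ (x (i , j + 1ℤ) ÷ x (i , j)) ⊗ stair i (j - 1ℤ) 0ℤ 0ℤ 0ℤ d
stair-down-first i j d = begin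
  stair i j 0ℤ 0ℤ 0ℤ (1ℤ + d)
    ≈⟨ stair-down-only i j (1ℤ + d) ⟩
  x a ÷ x (i , j + 1ℤ - (1ℤ + d))
    ≈⟨ ÷-telescope a (i , j) (i , j + 1ℤ - (1ℤ + d)) ⟩
  (x a ÷ x (i , j)) ⊗ (x (i , j) ÷ x (i , j + 1ℤ - (1ℤ + d)))
    ≡⟨ cong₂ (λ p q → (x a ÷ x (i , j)) ⊗ (x (i , p) ÷ x (i , q))) (lemma j) (down-shift⁺ j d) ⟩
  (x a ÷ x (i , j)) ⊗ (x (i , j - 1ℤ + 1ℤ) ÷ x (i , j - 1ℤ + 1ℤ - d))
    ≈⟨ ⊗-cong ≋-refl (stair-down-only i (j - 1ℤ) d) ⟨
  (x a ÷ x (i , j)) ⊗ stair i (j - 1ℤ) 0ℤ 0ℤ 0ℤ d ∎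
  where
  a = (i , j + 1ℤ)
  lemma : ∀ j → j ≡ j - 1ℤ + 1ℤ
  lemma = ℤ-Solver.solve-∀

stair-down-unit : ∀ i j → stair i j 0ℤ 0ℤ 0ℤ 1ℤ ≋ x (i , j + 1ℤ) ÷ x (i , j)
stair-down-unit i j = ≋-trans (stair-down-only i j 1ℤ)
  (≋-reflexive (cong (λ p → x (i , j + 1ℤ) ÷ x (i , p)) (lemma j)))
  where
  lemma : ∀ j → j + 1ℤ - 1ℤ ≡ j
  lemma = ℤ-Solver.solve-∀

-- Matches the layout of `term`: endpoint variable, first factor, remaining factors. Only the first
-- factor contributes a quotient; the others are merely translated.
⊗-pull : ∀ {e e′ f p p′ c g} → e ≡ e′ → f ≋ c ⊗ g → p ≡ p′ → e ⊗ (f ⊗ p) ≋ c ⊗ (e′ ⊗ (g ⊗ p′))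
⊗-pull {e} {f = f} {p} {c = c} {g} refl f≋cg refl =
  ≋-trans (⊗-cong ≋-refl (⊗-cong f≋cg ≋-refl))
    (solveᵣ 4 (λ e p c g → e ∗ (c ∗ g ∗ p) ≔ c ∗ (e ∗ (g ∗ p))) ≋-refl e p c g)

term-stepRight : ∀ i j w → term (i , j) (stepRight w) ≋
  (x (i - 1ℤ , j) ÷ x (i , j)) ⊗ term (i + 1ℤ , j) w
term-stepRight i j w@((r , d) ∷ ps) = ⊗-pull
  (cong (λ p → x (p , j - Σd w (suc k))) (right-shift i (Σr w (suc k))))
  (stair-right-first i j (Σr w 1) (Σd w 1))
  (∏<-cong k λ v → stair-right i j (Σr w (suc v)) (Σd w (suc v))
                               (Σr w (suc (suc v))) (Σd w (suc (suc v))))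
  where
  k = length ps

term-stepDown : ∀ i j w → term (i , j) (stepDown w) ≋
  (x (i , j + 1ℤ) ÷ x (i , j)) ⊗ term (i , j - 1ℤ) w
term-stepDown i j w@((zero , d) ∷ ps) = ⊗-pull
  (cong (λ q → x (i + Σr w (suc k) , q)) (down-shift j (Σd w (suc k))))
  (stair-down-first i j (Σd w 1))
  (∏<-cong k λ v → stair-down i j (Σr w (suc v)) (Σd w (suc v))
                               (Σr w (suc (suc v))) (Σd w (suc (suc v))))
  where
  k = length ps
term-stepDown i j w@((suc r , d) ∷ ps) = ≋-trans
  -- The new first pair `(0 , 1)` has no counterpart in `w`: its factor is the whole quotient, hence
  -- `1ᵣ`. All `suc k` old factors follow, each one index later.
  (⊗-pull {g = 1ᵣ}
    (cong (λ q → x (i + Σr w (suc k) , q)) (down-shift j (Σd w (suc k))))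
    (≋-trans (stair-down-unit i j) (≋-sym (⊗-identityʳ (x (i , j + 1ℤ) ÷ x (i , j)))))
    (∏<-cong (suc k) λ v → stair-down i j (Σr w v) (Σd w v) (Σr w (suc v)) (Σd w (suc v))))
  (⊗-cong ≋-refl (⊗-cong ≋-refl (⊗-identityˡ _)))
  where
  k = length ps

-- The induction can start at `n = 0`, where the single index `(0 , 0)` has trivial quotients and
-- yields `x (i , j)`. For paths it starts at length 1, since there is no path of length 0.
ψ-terms : ∀ n i j → ψ n n (i , j) ≋ ∑ₗ (term (i , j)) (allLengths n)
ψ-terms zero i j
  rewrite ℤₚ.+-identityʳ i | ℤₚ.+-identityʳ j = ≋-sym (begin
  x (i , j) ⊗ (X ⊗ Y ⊗ 1ᵣ) ⊕ 0ᵣ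
    ≈⟨ ⊕-identityʳ (x (i , j) ⊗ (X ⊗ Y ⊗ 1ᵣ)) ⟩
  x (i , j) ⊗ (X ⊗ Y ⊗ 1ᵣ)
    ≈⟨ ⊗-cong ≋-refl (⊗-identityʳ (X ⊗ Y)) ⟩
  x (i , j) ⊗ (X ⊗ Y)
    ≈⟨ ⊗-cong ≋-refl (⊗-cong (x÷x (i - 1ℤ + 0ℤ , j)) (x÷x (i , j + 1ℤ - 0ℤ))) ⟩
  x (i , j) ⊗ (1ᵣ ⊗ 1ᵣ)
    ≈⟨ ⊗-cong ≋-refl (⊗-identityʳ 1ᵣ) ⟩
  x (i , j) ⊗ 1ᵣ
    ≈⟨ ⊗-identityʳ (x (i , j)) ⟩
  x (i , j) ∎)
  where
  X = x (i - 1ℤ + 0ℤ , j) ÷ x (i - 1ℤ + 0ℤ , j)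
  Y = x (i , j + 1ℤ - 0ℤ) ÷ x (i , j + 1ℤ - 0ℤ)
ψ-terms (suc n) i j = begin
  ψ (suc n) (suc n) (i , j)
    ≈⟨ ψ-diagonal n i j ⟩
  (x (i - 1ℤ , j) ÷ x (i , j)) ⊗ ψ n n (i + 1ℤ , j) ⊕ (x (i , j + 1ℤ) ÷ x (i , j)) ⊗ ψ n n (i , j - 1ℤ)
    ≈⟨ ⊕-cong (⊗-cong ≋-refl (ψ-terms n (i + 1ℤ) j)) (⊗-cong ≋-refl (ψ-terms n i (j - 1ℤ))) ⟩
  (x (i - 1ℤ , j) ÷ x (i , j)) ⊗ ∑ₗ (term (i + 1ℤ , j)) W ⊕
  (x (i , j + 1ℤ) ÷ x (i , j)) ⊗ ∑ₗ (term (i , j - 1ℤ)) W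
    ≈⟨ ⊕-cong (∑ₗ-map (All.universal (term-stepRight i j) W))
              (∑ₗ-map (All.universal (term-stepDown i j) W)) ⟨
  ∑ₗ (term (i , j)) (map stepRight W) ⊕ ∑ₗ (term (i , j)) (map stepDown W)
    ≈⟨ ∑ₗ-++ (term (i , j)) (map stepRight W) (map stepDown W) ⟨
  ∑ₗ (term (i , j)) (allLengths (suc n)) ∎
  where
  W = allLengths n

proposition3p9 : (n : ℕ) → 1 ≤ n → (i j : ℤ) →
    (ψ n n (i , j) ≃ ∑ (stairPaths n (i , j)) weight) ×
    (ψ n n (i , j) ≃ ∑ (lengths n) (term (i , j)))
proposition3p9 (suc n) _ i j =
  -- `∑` over an enumeration unfolds to `∑ₗ` over its list, here the paths starting right followed
  -- by those starting down.
  unwrap (≋-trans (ψ-branches n i j) (≋-sym (∑ₗ-++ weight (chains right _ n) (chains down _ n)))) ,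
  unwrap (ψ-terms (suc n) i j)
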